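{- Let $K$ be a field of characteristic zero, let $(p_\lambda(x_1,x_2,\ldots))_{\lambda\in\mathcal P}$ be a full sequence of symmetric functions over $K$, and let $F^{y}$ be a shift-invariant $K$-linear operator from symmetric functions in $x_1,x_2,\ldots$ to symmetric functions in $x_1,x_2,\ldots$ with coefficients polynomial in $y$, such that for every partition $\lambda$ $$F^{y}p_\lambda(x_1,x_2,\ldots)=\sum_{\alpha}p_\alpha(x_1,x_2,\ldots)\,p_{\lambda-\alpha}(y,0,0,\ldots),$$ the sum ranging over all integer vectors $\alpha$ with finite support. Then there is a nonzero constant $c\in K$ with $F^{y}=cE^{y}$; in other words, $(\frac1c p_\lambda)_{\lambda\in\mathcal P}$ is a full divided power sequence of symmetric functions.
   Context: A partition $\lambda$ is an eventually zero weakly decreasing sequence $\lambda_1\ge\lambda_2\ge\cdots$ of natural numbers; $\mathcal P$ is the set of partitions and $\mathcal P_n$ those with sum $|\lambda|=n$. The conjugate $\lambda'$ is given by $\lambda'_i=|\{j:\lambda_j\ge i\}|$. Reverse lexicographic order: $\alpha\ll\beta$ iff there is $i$ with $\alpha_i<\beta_i$ and $\alpha_j=\beta_j$ for all $j>i$. $m_\mu$ denotes the monomial symmetric function. A full sequence $(p_\lambda)_{\lambda\in\mathcal P}$ consists of symmetric functions with $p_\lambda$ homogeneous of degree $|\lambda|$ and $p_\lambda=\sum_{\mu\in\mathcal P_{|\lambda|},\ \mu=\lambda'\text{ or }\lambda'\ll\mu}b_{\lambda\mu}m_\mu$ with the coefficient $b_{\lambda\lambda'}$ of $m_{\lambda'}$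 nonzero. For an integer vector $\alpha$ with finite support: if all $\alpha_i\ge0$, $p_\alpha:=p_\lambda$ where $\lambda$ is the partition obtained by sorting $\alpha$; if some $\alpha_i<0$, $p_\alpha:=0$. The symmetric shift is $E^{a}q(x_1,x_2,\ldots)=q(a,x_1,x_2,\ldots)$ (for a scalar $a$ or an indeterminate $y$). An operator $\theta$ is shift-invariant if $E^a\theta=\theta E^a$ for all $a\in K$. A full divided power sequence is a full sequence satisfying $E^yp_\lambda(x_1,x_2,\ldots)=\sum_\alpha p_\alpha(x_1,x_2,\ldots)p_{\lambda-\alpha}(y,0,0,\ldots)$ for all $\lambda$. -}

module Defs where

open import Level using (Level; 0ℓ; _⊔_)
open import Algebra.Apartness.Bundles using (HeytingField; HeytingCommutativeRing)
open import Algebra.Bundles using (CommutativeRing)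
open import Algebra.Module.Bundles.Raw using (RawLeftModule)
open import Algebra.Module.Morphism.Structures using (module LeftModuleMorphisms)
import Algebra.Properties.CommutativeMonoid.Sum as CommutativeMonoidSum
import Algebra.Properties.Monoid.Mult as MonoidMult
import Algebra.Properties.Ring as RingProperties
import Algebra.Properties.Semiring.Exp as SemiringExp
open import Data.Bool.Base using (if_then_else_)
open import Data.Fin.Base using (toℕ)
open import Data.Integer.Base using (ℤ; +_; -[1+_]; 0ℤ)
import Data.Integer.Base as ℤ
import Data.Integer.Properties as ℤ
open import Data.List.Base using (List; []; _∷_; [_]; _++_; map; foldr; filter; length; applyUpTo; upTo; cartesianProductWith)
open import Data.List.Membership.Propositional using (_∈_)
open import Data.List.Membership.Propositional.Properties using (∈-cartesianProductWith⁺; ∈-map⁺; ∈-upTo⁺)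
open import Data.List.Properties using (filter-++; filter-some; ++-identityʳ; ≡-dec)
open import Data.List.Relation.Binary.Equality.Propositional using (≋⇒≡)
open import Data.List.Relation.Binary.Permutation.Propositional using (_↭_; ↭-sym; ↭-trans; prep; ↭⇒↭ₛ′)
open import Data.List.Relation.Binary.Permutation.Propositional.Properties using (filter-↭; All-resp-↭)
open import Data.List.Relation.Binary.Sublist.Propositional using (⊆-refl)
open import Data.List.Relation.Binary.Sublist.Propositional.Properties using (filter⁺; length-mono-≤)
open import Data.List.Relation.Unary.All using (All; []; _∷_; all?)
open import Data.List.Relation.Unary.All.Properties using (all-filter; applyUpTo⁺₁)
open import Data.List.Relation.Unary.Any using (here)
open import Data.List.Relation.Unary.Linked using (Linked)
import Data.List.Relation.Unary.Linked.Properties as Linked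
open import Data.List.Relation.Unary.Sorted.TotalOrder.Properties using (↗↭↗⇒≋)
open import Data.List.Relation.Unary.Unique.Propositional using (Unique)
import Data.List.Sort as Sort
open import Data.Nat.Base using (ℕ; zero; suc; _≤_; _≥_; _<_; z≤n; s≤s)
import Data.Nat.Base as ℕ
open import Data.Nat.ListAction using (sum)
open import Data.Nat.ListAction.Properties using (sum-↭)
open import Data.Nat.Properties using (≤-decTotalOrder; ≤-trans; <-irrefl; <-≤-trans; m≤n+m; m≤m+n; m≤n⊔m; m≤m⊔n; n≤1+n; _≤?_; _<?_; _≟_)
open import Data.Product.Base using (∃-syntax; _×_; _,_)
open import Data.Sum.Base using (_⊎_)
open import Function.Bundles using (_⇔_)
open import Relation.Binary.Bundles using (DecTotalOrder; TotalOrder)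
open import Relation.Binary.Construct.Flip.EqAndOrd using () renaming (decTotalOrder to flipOrder)
open import Relation.Binary.PropositionalEquality.Core as ≡ using (_≡_; _≢_)
open import Relation.Nullary.Decidable using (does; dec-false)

≥-decTotalOrder : DecTotalOrder 0ℓ 0ℓ 0ℓ
≥-decTotalOrder = flipOrder ≤-decTotalOrder

open Sort ≥-decTotalOrder using (sort; sort-↭; sort-↗)

-- Eventually zero sequences are represented by finite lists, padded by
-- a default value beyond their end.

entry : ∀ {a} {A : Set a} → A → List A → ℕ → A
entry d []       _       = d
entry d (x ∷ _)  zero    = x
entry d (_ ∷ xs) (suc i) = entry d xs i

-- A partition is stored as the list of its nonzero parts, so that equal
-- partitions have equal lists.

record Partition : Set where
  constructor mkPartition
  field
    parts      : List ℕ
    decreasing : Linked _≥_ parts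
    positive   : All (0 <_) parts

open Partition public

-- The i-th part, counting from 0.
part : Partition → ℕ → ℕ
part ν = entry 0 (parts ν)

size : Partition → ℕ
size ν = sum (parts ν)

_≪_ : Partition → Partition → Set
α ≪ β = ∃[ i ] part α i < part β i × (∀ j → i < j → part α j ≡ part β j)

count≥ : ℕ → List ℕ → ℕ
count≥ i xs = length (filter (i ≤?_) xs)

private
  count≥-antitone : ∀ i xs → count≥ (suc i) xs ≤ count≥ i xs
  count≥-antitone i xs = length-mono-≤
    (filter⁺ (suc i ≤?_) (i ≤?_) (λ { ≡.refl i<x → ≤-trans (n≤1+n i) i<x }) (⊆-refl {x = xs}))

  count≥-positive : ∀ xs {i} → i < entry 0 xs 0 → 0 < count≥ (suc i) xs
  count≥-positive (x ∷ xs) i<x = filter-some (suc _ ≤?_) (here i<x)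

conjugate : Partition → Partition
conjugate ν = mkPartition
  (applyUpTo (λ i → count≥ (suc i) (parts ν)) (part ν 0))
  (Linked.applyUpTo⁺₂ _ (part ν 0) (λ i → count≥-antitone (suc i) (parts ν)))
  (applyUpTo⁺₁ _ (part ν 0) (count≥-positive (parts ν)))

-- The partition obtained by sorting a vector of natural numbers.

toPartition : List ℕ → Partition
toPartition β = mkPartition
  (sort (filter (0 <?_) β))
  (sort-↗ _)
  (All-resp-↭ (↭-sym (sort-↭ _)) (all-filter (0 <?_) β))

private
  sum-nonzero : ∀ β → sum (filter (0 <?_) β) ≡ sum β
  sum-nonzero []          = ≡.refl
  sum-nonzero (zero ∷ β)  = sum-nonzero β
  sum-nonzero (suc n ∷ β) = ≡.cong (suc n ℕ.+_) (sum-nonzero β)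

size-toPartition : ∀ β → size (toPartition β) ≡ sum β
size-toPartition β = ≡.trans (sum-↭ (sort-↭ _)) (sum-nonzero β)

parts-toPartition-↭ : ∀ {β γ} → β ↭ γ → parts (toPartition β) ≡ parts (toPartition γ)
parts-toPartition-↭ β↭γ = ≋⇒≡ (↗↭↗⇒≋ ≥-totalOrder (sort-↗ _) (sort-↗ _)
  (↭⇒↭ₛ′ (TotalOrder.isEquivalence ≥-totalOrder)
    (↭-trans (sort-↭ _) (↭-trans (filter-↭ (0 <?_) β↭γ) (↭-sym (sort-↭ _))))))
  where ≥-totalOrder = DecTotalOrder.totalOrder ≥-decTotalOrder

parts-toPartition-0 : ∀ β → parts (toPartition (β ++ [ 0 ])) ≡ parts (toPartition β)
parts-toPartition-0 β = ≡.cong sort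
  (≡.trans (filter-++ (0 <?_) β [ 0 ]) (++-identityʳ _))

-- Integer vectors of finite support, as lists padded by zeros.

_−_ : List ℤ → List ℤ → List ℤ
[]       − β       = map ℤ.-_ β
(a ∷ α)  − []      = a ∷ α
(a ∷ α)  − (b ∷ β) = (a ℤ.- b) ∷ (α − β)

NonNegative : List ℤ → Set
NonNegative = All (0ℤ ℤ.≤_)

-- All α with 0 ≤ αᵢ ≤ νᵢ for every i, each listed once.
box : List ℕ → List (List ℤ)
box []       = [ [] ]
box (n ∷ ns) = cartesianProductWith _∷_ (map +_ (upTo (suc n))) (box ns)

-- Every integer vector α for which neither α nor ν − α has a negative
-- entry is in the box of ν, up to trailing zeros.
box-complete : ∀ ν α → NonNegative α → NonNegative (map +_ ν − α) →
               ∃[ β ] β ∈ box ν × (∀ i → entry 0ℤ α i ≡ entry 0ℤ β i)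
box-complete [] α α≥0 -α≥0 = [] , here ≡.refl , zeros α α≥0 -α≥0
  where
  zeros : ∀ α → NonNegative α → NonNegative (map ℤ.-_ α) →
          ∀ i → entry 0ℤ α i ≡ 0ℤ
  zeros []               _         _         _       = ≡.refl
  zeros (+ zero ∷ α)     _         _         zero    = ≡.refl
  zeros (+ suc _ ∷ α)    _         (() ∷ _)  _
  zeros (-[1+ _ ] ∷ α)   (() ∷ _)  _         _
  zeros (+ zero ∷ α)     (_ ∷ α≥0) (_ ∷ -α≥0) (suc i) = zeros α α≥0 -α≥0 i
box-complete (n ∷ ν) [] _ (_ ∷ ν≥0) =
  let β , β∈ , eq = box-complete ν [] [] (≡.subst NonNegative (≡.sym (−-[] (map +_ ν))) ν≥0) in
  + 0 ∷ β ,
  ∈-cartesianProductWith⁺ _∷_ (∈-map⁺ +_ (∈-upTo⁺ {suc n} (s≤s z≤n))) β∈ ,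
  λ { zero → ≡.refl ; (suc i) → eq i }
  where
  −-[] : ∀ γ → γ − [] ≡ γ
  −-[] []      = ≡.refl
  −-[] (_ ∷ _) = ≡.refl
box-complete (n ∷ ν) (-[1+ _ ] ∷ α) (() ∷ _) _
box-complete (n ∷ ν) (+ k ∷ α) (_ ∷ α≥0) (n-k≥0 ∷ ν-α≥0) =
  let β , β∈ , eq = box-complete ν α α≥0 ν-α≥0 in
  + k ∷ β ,
  ∈-cartesianProductWith⁺ _∷_ (∈-map⁺ +_ (∈-upTo⁺ {suc n} (s≤s (ℤ.drop‿+≤+ (ℤ.0≤i-j⇒j≤i n-k≥0))))) β∈ ,
  λ { zero → ≡.refl ; (suc i) → eq i }

-- A Heyting field is, classically, a field: "nonzero" is apartness from 0#.
module SymmetricFunctions {c ℓ₁ ℓ₂ : Level} (K : HeytingField c ℓ₁ ℓ₂) where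

  open HeytingField K using (Carrier; _≈_; _#_; heytingCommutativeRing)

  commutativeRing : CommutativeRing c ℓ₁
  commutativeRing = HeytingCommutativeRing.commutativeRing heytingCommutativeRing

  open CommutativeRing commutativeRing
    using ( _+_; _*_; -_; 0#; 1#; refl; sym; trans; reflexive; ring; semiring
          ; +-monoid; +-commutativeMonoid; +-cong; *-cong; -‿cong; +-identityˡ; zeroˡ; zeroʳ)
  open CommutativeMonoidSum +-commutativeMonoid
    using (sum-cong-≋; sum-replicate-zero) renaming (sum to ∑)
  open MonoidMult +-monoid using () renaming (_×_ to _×ᴷ_)
  open RingProperties ring using (-0#≈0#)
  open SemiringExp semiring using (_^_)

  CharacteristicZero : Set ℓ₂
  CharacteristicZero = ∀ n → (suc n ×ᴷ 1#) # 0#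

  -- A symmetric function is a formal power series of bounded degree in
  -- x₁, x₂, …, invariant under permutations of the variables.  `coeff β`
  -- is the coefficient of x₁^β₁ x₂^β₂ ⋯ x_k^β_k, so it must not change
  -- when zeros are appended to β.  `degree` is only an upper bound; it is
  -- ignored by the equality _≈ˢ_.

  record Sym : Set (c ⊔ ℓ₁) where
    field
      coeff     : List ℕ → Carrier
      degree    : ℕ
      symmetric : ∀ {β γ} → β ↭ γ → coeff β ≈ coeff γ
      padded    : ∀ β → coeff (β ++ [ 0 ]) ≈ coeff β
      bounded   : ∀ {β} → degree < sum β → coeff β ≈ 0#

  open Sym public

  infix 4 _≈ˢ_ _≈ʸ_
  infixl 6 _+ˢ_ _+ʸ_
  infixr 7 _•_ _•ʸ_

  _≈ˢ_ : Sym → Sym → Set ℓ₁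
  q ≈ˢ r = ∀ β → coeff q β ≈ coeff r β

  0ˢ : Sym
  0ˢ = record
    { coeff     = λ _ → 0#
    ; degree    = 0
    ; symmetric = λ _ → refl
    ; padded    = λ _ → refl
    ; bounded   = λ _ → refl
    }

  _+ˢ_ : Sym → Sym → Sym
  q +ˢ r = record
    { coeff     = λ β → coeff q β + coeff r β
    ; degree    = degree q ℕ.⊔ degree r
    ; symmetric = λ β↭γ → +-cong (symmetric q β↭γ) (symmetric r β↭γ)
    ; padded    = λ β → +-cong (padded q β) (padded r β)
    ; bounded   = λ d< → trans
        (+-cong (bounded q (≤-trans (s≤s (m≤m⊔n _ _)) d<))
                (bounded r (≤-trans (s≤s (m≤n⊔m (degree q) _)) d<)))
        (+-identityˡ 0#)
    }

  -ˢ_ : Sym → Sym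
  -ˢ q = record
    { coeff     = λ β → - coeff q β
    ; degree    = degree q
    ; symmetric = λ β↭γ → -‿cong (symmetric q β↭γ)
    ; padded    = λ β → -‿cong (padded q β)
    ; bounded   = λ d< → trans (-‿cong (bounded q d<)) -0#≈0#
    }

  _•_ : Carrier → Sym → Sym
  a • q = record
    { coeff     = λ β → a * coeff q β
    ; degree    = degree q
    ; symmetric = λ β↭γ → *-cong refl (symmetric q β↭γ)
    ; padded    = λ β → *-cong refl (padded q β)
    ; bounded   = λ d< → trans (*-cong refl (bounded q d<)) (zeroʳ a)
    }

  ∑ˢ : List Sym → Sym
  ∑ˢ = foldr _+ˢ_ 0ˢ

  symModule : RawLeftModule Carrier (c ⊔ ℓ₁) ℓ₁
  symModule = record
    { Carrierᴹ = Sym ; _≈ᴹ_ = _≈ˢ_ ; _+ᴹ_ = _+ˢ_ ; _*ₗ_ = _•_ ; 0ᴹ = 0ˢ ; -ᴹ_ = -ˢ_ }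

  indicator : Partition → List ℕ → Carrier
  indicator μ ps = if does (≡-dec _≟_ ps (parts μ)) then 1# else 0#

  -- The sum of all distinct monomials whose exponent vector is a
  -- rearrangement of μ.
  monomial : Partition → Sym
  monomial μ = record
    { coeff     = λ β → indicator μ (parts (toPartition β))
    ; degree    = size μ
    ; symmetric = λ β↭γ → reflexive (≡.cong (indicator μ) (parts-toPartition-↭ β↭γ))
    ; padded    = λ β → reflexive (≡.cong (indicator μ) (parts-toPartition-0 β))
    ; bounded   = λ {β} d< → reflexive (≡.cong (λ b → if b then 1# else 0#)
        (dec-false (≡-dec _≟_ (parts (toPartition β)) (parts μ))
          (λ eq → <-irrefl (≡.trans (≡.cong sum (≡.sym eq)) (size-toPartition β)) d<)))
    }

  -- Σ_{i ≤ d} aⁱ fᵢ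
  evaluate : Carrier → ℕ → (ℕ → Carrier) → Carrier
  evaluate a d f = ∑ {suc d} (λ i → a ^ toℕ i * f (toℕ i))

  private
    evaluate-cong : ∀ a d {f g : ℕ → Carrier} → (∀ i → f i ≈ g i) → evaluate a d f ≈ evaluate a d g
    evaluate-cong a d {f} {g} f≈g = sum-cong-≋ {suc d}
      {x = λ i → a ^ toℕ i * f (toℕ i)} {y = λ i → a ^ toℕ i * g (toℕ i)}
      (λ i → *-cong refl (f≈g (toℕ i)))

    evaluate-0 : ∀ a d {f : ℕ → Carrier} → (∀ i → f i ≈ 0#) → evaluate a d f ≈ 0#
    evaluate-0 a d {f} f≈0 = trans
      (sum-cong-≋ {suc d} {x = λ i → a ^ toℕ i * f (toℕ i)}
        (λ i → trans (*-cong refl (f≈0 (toℕ i))) (zeroʳ _)))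
      (sum-replicate-zero (suc d))

  -- E^a: the coefficient of x^β in q(a, x₁, x₂, …) is Σᵢ aⁱ [x₁ⁱ x₂^β₁ x₃^β₂ ⋯] q.
  E : Carrier → Sym → Sym
  E a q = record
    { coeff     = λ β → evaluate a (degree q) (λ i → coeff q (i ∷ β))
    ; degree    = degree q
    ; symmetric = λ β↭γ → evaluate-cong a (degree q) (λ i → symmetric q (prep i β↭γ))
    ; padded    = λ β → evaluate-cong a (degree q) (λ i → padded q (i ∷ β))
    ; bounded   = λ {β} d< → evaluate-0 a (degree q)
        {f = λ i → coeff q (i ∷ β)} (λ i → bounded q (<-≤-trans d< (m≤n+m (sum β) i)))
    }

  -- Symmetric functions in x₁, x₂, … with coefficients polynomial in y,
  -- written as polynomials Σᵢ (coeffʸ i) yⁱ.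

  record Sym[y] : Set (c ⊔ ℓ₁) where
    field
      coeffʸ   : ℕ → Sym
      degreeʸ  : ℕ
      boundedʸ : ∀ {i} → degreeʸ < i → coeffʸ i ≈ˢ 0ˢ

  open Sym[y] public

  _≈ʸ_ : Sym[y] → Sym[y] → Set ℓ₁
  f ≈ʸ g = ∀ i → coeffʸ f i ≈ˢ coeffʸ g i

  0ʸ : Sym[y]
  0ʸ = record { coeffʸ = λ _ → 0ˢ ; degreeʸ = 0 ; boundedʸ = λ _ _ → refl }

  _+ʸ_ : Sym[y] → Sym[y] → Sym[y]
  f +ʸ g = record
    { coeffʸ   = λ i → coeffʸ f i +ˢ coeffʸ g i
    ; degreeʸ  = degreeʸ f ℕ.⊔ degreeʸ g
    ; boundedʸ = λ d< β → trans
        (+-cong (boundedʸ f (≤-trans (s≤s (m≤m⊔n _ _)) d<) β)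
                (boundedʸ g (≤-trans (s≤s (m≤n⊔m (degreeʸ f) _)) d<) β))
        (+-identityˡ 0#)
    }

  -ʸ_ : Sym[y] → Sym[y]
  -ʸ f = record
    { coeffʸ   = λ i → -ˢ coeffʸ f i
    ; degreeʸ  = degreeʸ f
    ; boundedʸ = λ d< β → trans (-‿cong (boundedʸ f d< β)) -0#≈0#
    }

  _•ʸ_ : Carrier → Sym[y] → Sym[y]
  a •ʸ f = record
    { coeffʸ   = λ i → a • coeffʸ f i
    ; degreeʸ  = degreeʸ f
    ; boundedʸ = λ d< β → trans (*-cong refl (boundedʸ f d< β)) (zeroʳ a)
    }

  ∑ʸ : List Sym[y] → Sym[y]
  ∑ʸ = foldr _+ʸ_ 0ʸ

  sym[y]Module : RawLeftModule Carrier (c ⊔ ℓ₁) ℓ₁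
  sym[y]Module = record
    { Carrierᴹ = Sym[y] ; _≈ᴹ_ = _≈ʸ_ ; _+ᴹ_ = _+ʸ_ ; _*ₗ_ = _•ʸ_ ; 0ᴹ = 0ʸ ; -ᴹ_ = -ʸ_ }

  open LeftModuleMorphisms symModule sym[y]Module public
    using () renaming (IsLeftModuleHomomorphism to IsLinear)

  -- E^y: the coefficient of yⁱ x^β in q(y, x₁, x₂, …) is [x₁ⁱ x₂^β₁ x₃^β₂ ⋯] q.
  Eʸ : Sym → Sym[y]
  Eʸ q = record
    { coeffʸ   = λ i → record
        { coeff     = λ β → coeff q (i ∷ β)
        ; degree    = degree q
        ; symmetric = λ β↭γ → symmetric q (prep i β↭γ)
        ; padded    = λ β → padded q (i ∷ β)
        ; bounded   = λ {β} d< → bounded q (<-≤-trans d< (m≤n+m (sum β) i))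
        }
    ; degreeʸ  = degree q
    ; boundedʸ = λ {i} d< β → bounded q (<-≤-trans d< (m≤m+n i (sum β)))
    }

  -- E^a acts on the x-variables only, so coefficientwise in y.
  Eᵃʸ : Carrier → Sym[y] → Sym[y]
  Eᵃʸ a f = record
    { coeffʸ   = λ i → E a (coeffʸ f i)
    ; degreeʸ  = degreeʸ f
    ; boundedʸ = λ {i} d< → λ β → evaluate-0 a (degree (coeffʸ f i)) (λ j → boundedʸ f d< (j ∷ β))
    }

  ShiftInvariant : (Sym → Sym[y]) → Set (c ⊔ ℓ₁)
  ShiftInvariant θ = ∀ a q → Eᵃʸ a (θ q) ≈ʸ θ (E a q)

  -- q(x₁, x₂, …) · r(y, 0, 0, …): the coefficient of yⁱ in the second
  -- factor is that of x₁ⁱ in r.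
  _·_⟨y⟩ : Sym → Sym → Sym[y]
  q · r ⟨y⟩ = record
    { coeffʸ   = λ i → coeff r [ i ] • q
    ; degreeʸ  = degree r
    ; boundedʸ = λ {i} d< β → trans
        (*-cong (bounded r (<-≤-trans d< (m≤m+n i 0))) refl) (zeroˡ _)
    }

  Homogeneous : ℕ → Sym → Set ℓ₁
  Homogeneous n q = ∀ β → sum β ≢ n → coeff q β ≈ 0#

  -- `support` enumerates the finite set of partitions over which the
  -- expansion of p_ν ranges.
  record IsFullAt (ν : Partition) (q : Sym) : Set (c ⊔ ℓ₁ ⊔ ℓ₂) where
    field
      homogeneous : Homogeneous (size ν) q
      support     : List Partition
      unique      : Unique support
      complete    : ∀ μ → μ ∈ support ⇔ (size μ ≡ size ν × (μ ≡ conjugate ν ⊎ conjugate ν ≪ μ))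
      b           : Partition → Carrier
      leading     : b (conjugate ν) # 0#
      expansion   : q ≈ˢ ∑ˢ (map (λ μ → b μ • monomial μ) support)

  IsFull : (Partition → Sym) → Set (c ⊔ ℓ₁ ⊔ ℓ₂)
  IsFull p = ∀ ν → IsFullAt ν (p ν)

  -- p_α for an integer vector α.
  _at_ : (Partition → Sym) → List ℤ → Sym
  p at α = if does (all? (0ℤ ℤ.≤?_) α) then p (toPartition (map ℤ.∣_∣ α)) else 0ˢ

  -- Σ_α p_α(x₁, x₂, …) p_{ν−α}(y, 0, 0, …) over all integer vectors α of
  -- finite support: by `box-complete`, the terms outside the box of ν
  -- have a factor p_α or p_{ν−α} that is 0 by definition.
  convolution : (Partition → Sym) → Partition → Sym[y]
  convolution p ν =
    ∑ʸ (map (λ α → (p at α) · (p at (map +_ (parts ν) − α)) ⟨y⟩) (box (parts ν)))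

  record IsFullDividedPower (p : Partition → Sym) : Set (c ⊔ ℓ₁ ⊔ ℓ₂) where
    field
      isFull       : IsFull p
      dividedPower : ∀ ν → Eʸ (p ν) ≈ʸ convolution p ν

{-# OPTIONS --safe #-}

-- The constant term (x = 0) of F^y p_ν is c p_ν(y,0,0,…) with c = p_∅,
-- because p_α has no constant term unless α = 0.  A full sequence is
-- triangular with nonzero diagonal with respect to the monomial
-- symmetric functions, hence spans, so the constant term of F^y q is
-- c q(y,0,0,…) for every q.  As K is infinite, commuting with all E^a means
-- commuting with every D_j, where E^a = Σ_j a^j D_j; and D_j reads off
-- coefficients: [x^(j,β)] q = [x^β] (D_j q).  So all coefficients of F^y q are
-- determined by constant terms, and F^y = c E^y.

module Submission where

open import Defs
open import Algebra.Apartness.Bundles using (HeytingField)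
import Algebra.Apartness.Properties.HeytingCommutativeRing as HeytingProperties
open import Algebra.Bundles using (CommutativeRing)
import Algebra.Properties.CommutativeMonoid.Sum as CommutativeMonoidSum
import Algebra.Properties.CommutativeSemigroup as CommutativeSemigroupProperties
import Algebra.Properties.Monoid.Mult as MonoidMult
import Algebra.Properties.Ring as RingProperties
import Algebra.Properties.Semiring.Exp as SemiringExp
import Algebra.Properties.Semiring.Mult as SemiringMult
import Algebra.Properties.Semiring.Sum as SemiringSum
open import Data.Bool.Base using (true; false; if_then_else_)
open import Data.Empty using (⊥-elim)
open import Data.Fin.Base using (Fin; toℕ)
open import Data.Integer.Base as ℤ using (ℤ; +_; 0ℤ; ∣_∣)
import Data.Integer.Properties as ℤ
open import Data.List.Base using (List; []; _∷_; [_]; _++_; map; filter; foldr; length; replicate; applyUpTo; upTo)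
open import Data.List.Membership.Propositional using (_∈_)
open import Data.List.Membership.Propositional.Properties using (∈-map⁻; ∈-applyUpTo⁻; ∈-upTo⁺; ∈-upTo⁻)
open import Data.List.Properties using (≡-dec; ++-assoc; ++-identityʳ; filter-accept; filter-all; filter-reject; map-∘; map-id)
open import Data.List.Relation.Binary.Equality.Propositional using (≋⇒≡)
open import Data.List.Relation.Binary.Permutation.Propositional using (_↭_; ↭-refl; ↭-sym; ↭-trans; prep; swap; ↭⇒↭ₛ′)
open import Data.List.Relation.Binary.Permutation.Propositional.Properties using (shift; ++⁺ʳ)
open import Data.List.Relation.Unary.All as All using (All; []; _∷_; all?)
import Data.List.Relation.Unary.All.Properties as All
open import Data.List.Relation.Unary.AllPairs using ([]; _∷_)
open import Data.List.Relation.Unary.Any using (here; there)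
open import Data.List.Relation.Unary.Linked as Linked using (Linked; []; [-]; _∷_)
open import Data.List.Relation.Unary.Sorted.TotalOrder.Properties using (↗↭↗⇒≋)
open import Data.List.Relation.Unary.Unique.Propositional using (Unique)
open import Data.List.Relation.Unary.Unique.Propositional.Properties using (upTo⁺)
import Data.List.Sort as Sort
open import Data.Nat.Base as ℕ using (ℕ; zero; suc; _≤_; _<_; z≤n; s≤s)
open import Data.Nat.ListAction using (sum)
import Data.Nat.Properties as ℕ
open import Data.Product.Base using (∃-syntax; _×_; _,_; proj₁; proj₂)
open import Data.Sum.Base using (_⊎_; inj₁; inj₂; [_,_]′)
open import Function.Base using (_∘_)
open import Function.Bundles using (_⇔_; mk⇔; module Equivalence)
open import Level using (Level; _⊔_)
open import Relation.Binary.Bundles using (DecTotalOrder; TotalOrder)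
open import Relation.Binary.PropositionalEquality as ≡ using (_≡_; _≢_)
import Relation.Binary.Reasoning.Setoid as SetoidReasoning
open import Relation.Nullary using (¬_; yes; no; does)
open import Relation.Nullary.Decidable using (dec-true; dec-false)

-- Partitions, conjugation and reverse lexicographic order

-- The hypothesis on F is quadratic in p, and its other terms involve p at vectors unrelated to ν.
-- Setting x = 0 makes it usable: what survives is linear in p_ν, with a factor p_∅ that does not
-- depend on ν. This factor is nonzero because it is the leading coefficient of p at the empty
-- partition.
--
-- That p spans is used in dual form. Two linear functionals agreeing on every p_ν are shown to
-- agree on every monomial symmetric function and then on every q; no expansion of q in the p_ν is
-- constructed.
--
-- The quadratic shape also dictates the normalisation: dividing p by c divides the convolution by
-- c² but E^y p_ν only by c, which absorbs the c in F^y = c E^y.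

module Partitions where

  open import Data.Nat.Base
  open import Data.Nat.Properties
  open Sort ≥-decTotalOrder using (sort-↭; sort-↗)
  open ≡ using (refl; sym; trans; cong; cong₂; subst; module ≡-Reasoning)

  partition-≡ : ∀ {μ ν} → parts μ ≡ parts ν → μ ≡ ν
  partition-≡ {mkPartition xs d p} {mkPartition _ d′ p′} refl =
    cong₂ (mkPartition xs) (Linked.irrelevant ≤-irrelevant d d′) (All.irrelevant <-irrelevant p p′)

  entry-injective : ∀ {xs ys} → All (0 <_) xs → All (0 <_) ys →
                    (∀ i → entry 0 xs i ≡ entry 0 ys i) → xs ≡ ys
  entry-injective []         []         eq = refl
  entry-injective []         (0<y ∷ _)  eq = ⊥-elim (<-irrefl (eq 0) 0<y)
  entry-injective (0<x ∷ _)  []         eq = ⊥-elim (<-irrefl (sym (eq 0)) 0<x)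
  entry-injective (_ ∷ xs>0) (_ ∷ ys>0) eq =
    cong₂ _∷_ (eq 0) (entry-injective xs>0 ys>0 (eq ∘ suc))

  part-injective : ∀ {μ ν} → (∀ i → part μ i ≡ part ν i) → μ ≡ ν
  part-injective {μ} {ν} eq = partition-≡ (entry-injective (positive μ) (positive ν) eq)

  entry≤sum : ∀ xs i → entry 0 xs i ≤ sum xs
  entry≤sum []       i       = z≤n
  entry≤sum (x ∷ xs) zero    = m≤m+n x (sum xs)
  entry≤sum (x ∷ xs) (suc i) = ≤-trans (entry≤sum xs i) (m≤n+m (sum xs) x)

  positive-entry⇒index<sum : ∀ {xs i} → All (0 <_) xs → 0 < entry 0 xs i → i < sum xs
  positive-entry⇒index<sum {x ∷ xs} {zero}  _            0<x = ≤-trans 0<x (m≤m+n x (sum xs))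
  positive-entry⇒index<sum {_}      {suc i} (0<x ∷ xs>0) 0<e =
    +-mono-≤ 0<x (positive-entry⇒index<sum xs>0 0<e)

  entry≤head : ∀ {x xs} → Linked _≥_ (x ∷ xs) → ∀ i → entry 0 (x ∷ xs) i ≤ x
  entry≤head _           zero    = ≤-refl
  entry≤head [-]         (suc i) = z≤n
  entry≤head (x≥y ∷ ys↘) (suc i) = ≤-trans (entry≤head ys↘ i) x≥y

  -- Conjugation as transposition of diagrams

  count≥-accept : ∀ {i x} xs → i ≤ x → count≥ i (x ∷ xs) ≡ suc (count≥ i xs)
  count≥-accept {i} xs i≤x = cong length (filter-accept (i ≤?_) {xs = xs} i≤x)

  count≥-reject : ∀ {i x} xs → ¬ i ≤ x → count≥ i (x ∷ xs) ≡ count≥ i xs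
  count≥-reject {i} xs i≰x = cong length (filter-reject (i ≤?_) {xs = xs} i≰x)

  -- In a decreasing list the entries above `i` form an initial segment, so their number exceeds `j`
  -- exactly when the entry at index `j` is one of them.
  <entry⇒<count≥ : ∀ {xs i j} → Linked _≥_ xs → i < entry 0 xs j → j < count≥ (suc i) xs
  <entry⇒<count≥ {x ∷ xs} {i} {j} xs↘ i<e
    rewrite count≥-accept xs (≤-trans i<e (entry≤head xs↘ j)) with j
  ... | zero   = z<s
  ... | suc j′ = s<s (<entry⇒<count≥ (Linked.tail xs↘) i<e)

  <count≥⇒<entry : ∀ {xs i j} → Linked _≥_ xs → j < count≥ (suc i) xs → i < entry 0 xs j
  <count≥⇒<entry {x ∷ xs} {i} {j} xs↘ j<c with suc i ≤? x
  ... | no  i≮x rewrite count≥-reject xs i≮x =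
    ⊥-elim (i≮x (≤-trans (<count≥⇒<entry (Linked.tail xs↘) j<c) (entry≤head xs↘ (suc j))))
  ... | yes i<x rewrite count≥-accept xs i<x with j
  ...   | zero   = i<x
  ...   | suc j′ = <count≥⇒<entry (Linked.tail xs↘) (s<s⁻¹ j<c)

  entry-applyUpTo : ∀ f n i → (n ≤ i → f i ≡ 0) → entry 0 (applyUpTo f n) i ≡ f i
  entry-applyUpTo f zero    i       f≡0 = sym (f≡0 z≤n)
  entry-applyUpTo f (suc n) zero    f≡0 = refl
  entry-applyUpTo f (suc n) (suc i) f≡0 = entry-applyUpTo (f ∘ suc) n i (f≡0 ∘ s≤s)

  part-conjugate : ∀ ν i → part (conjugate ν) i ≡ count≥ (suc i) (parts ν)
  part-conjugate ν i = entry-applyUpTo _ (part ν 0) i λ ν₀≤i →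
    n≤0⇒n≡0 (≮⇒≥ λ 0<c → <⇒≱ (<count≥⇒<entry (decreasing ν) 0<c) ν₀≤i)

  -- Both inequalities say that the same cell lies in the Young diagram of `ν`, read once by columns
  -- and once by rows.
  conjugate-galois : ∀ ν {i j} → i < part (conjugate ν) j → j < part ν i
  conjugate-galois ν {i} {j} i<ν′ =
    <count≥⇒<entry (decreasing ν) (subst (i <_) (part-conjugate ν j) i<ν′)

  conjugate-galois⁻¹ : ∀ ν {i j} → j < part ν i → i < part (conjugate ν) j
  conjugate-galois⁻¹ ν {i} {j} j<ν =
    subst (i <_) (sym (part-conjugate ν j)) (<entry⇒<count≥ (decreasing ν) j<ν)

  -- A strict inequality in either direction, carried through the transposition twice, would make a
  -- part smaller than itself.
  conjugate-involutive : ∀ ν → conjugate (conjugate ν) ≡ ν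
  conjugate-involutive ν = part-injective λ i → ≤-antisym
    (≮⇒≥ λ < → <-irrefl refl (conjugate-galois ν (conjugate-galois (conjugate ν) <)))
    (≮⇒≥ λ < → <-irrefl refl (conjugate-galois⁻¹ (conjugate ν) (conjugate-galois⁻¹ ν <)))

  sum-applyUpTo-0 : ∀ n → sum (applyUpTo (λ _ → 0) n) ≡ 0
  sum-applyUpTo-0 zero    = refl
  sum-applyUpTo-0 (suc n) = sum-applyUpTo-0 n

  -- Serves the case of a new row of length `x` in a diagram: exactly the first `x` columns grow by
  -- one cell.
  sum-applyUpTo-suc : ∀ {f g : ℕ → ℕ} {x n} → x ≤ n →
                      (∀ i → i < x → f i ≡ suc (g i)) → (∀ i → x ≤ i → f i ≡ g i) →
                      sum (applyUpTo f n) ≡ x + sum (applyUpTo g n)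
  sum-applyUpTo-suc {x = zero}  {zero}  _   _  _  = refl
  sum-applyUpTo-suc {x = zero}  {suc n} _   _  f≡ =
    cong₂ _+_ (f≡ 0 z≤n) (sum-applyUpTo-suc {x = 0} {n} z≤n (λ _ ()) (λ i _ → f≡ (suc i) z≤n))
  sum-applyUpTo-suc {f} {g} {suc x} {suc n} x≤n f≡s f≡ = begin
    f 0 + sum (applyUpTo (f ∘ suc) n)
      ≡⟨ cong₂ _+_ (f≡s 0 z<s) (sum-applyUpTo-suc {x = x} (s≤s⁻¹ x≤n) (λ i → f≡s (suc i) ∘ s<s) (λ i → f≡ (suc i) ∘ s≤s)) ⟩
    suc (g 0 + (x + sum (applyUpTo (g ∘ suc) n)))
      ≡⟨ cong suc (sym (+-assoc (g 0) x _)) ⟩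
    suc (g 0 + x + sum (applyUpTo (g ∘ suc) n))
      ≡⟨ cong (λ k → suc (k + sum (applyUpTo (g ∘ suc) n))) (+-comm (g 0) x) ⟩
    suc (x + g 0 + sum (applyUpTo (g ∘ suc) n))
      ≡⟨ cong suc (+-assoc x (g 0) _) ⟩
    suc (x + (g 0 + sum (applyUpTo (g ∘ suc) n))) ∎
    where open ≡-Reasoning

  -- Double counting of cells. The bound `n` is kept free because the head of the list changes in
  -- the induction.
  sum-count≥ : ∀ {n} xs → All (_≤ n) xs → sum (applyUpTo (λ i → count≥ (suc i) xs) n) ≡ sum xs
  sum-count≥ {n} []       []           = sum-applyUpTo-0 n
  sum-count≥ {n} (x ∷ xs) (x≤n ∷ xs≤n) = trans
    (sum-applyUpTo-suc x≤n
      (λ _ → count≥-accept xs)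
      (λ _ x≤i → count≥-reject xs (≤⇒≯ x≤i)))
    (cong (λ s → x + s) (sum-count≥ xs xs≤n))

  all≤head : ∀ {xs} → Linked _≥_ xs → All (_≤ entry 0 xs 0) xs
  all≤head []          = []
  all≤head [-]         = ≤-refl ∷ []
  all≤head (x≥y ∷ ys↘) = ≤-refl ∷ All.map (λ z≤y → ≤-trans z≤y x≥y) (all≤head ys↘)

  size-conjugate : ∀ ν → size (conjugate ν) ≡ size ν
  size-conjugate ν = sum-count≥ (parts ν) (all≤head (decreasing ν))

  size0⇒≡ : ∀ {μ ν} → size μ ≡ 0 → size ν ≡ 0 → μ ≡ ν
  size0⇒≡ {μ} {ν} |μ|≡0 |ν|≡0 = part-injective λ i → trans (part≡0 μ |μ|≡0 i) (sym (part≡0 ν |ν|≡0 i))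
    where
    part≡0 : ∀ μ → size μ ≡ 0 → ∀ i → part μ i ≡ 0
    part≡0 μ |μ|≡0 i = n≤0⇒n≡0 (subst (part μ i ≤_) |μ|≡0 (entry≤sum (parts μ) i))

  -- The number with `k` digits in base `B`, least significant first, so that the last differing
  -- digit decides a comparison, just as in `≪`.
  value : ℕ → ℕ → (ℕ → ℕ) → ℕ
  value B zero    f = 0
  value B (suc k) f = f 0 + B * value B k (f ∘ suc)

  -- A digit below the base cannot make up for a deficit in the higher digits.
  carry : ∀ {x B} v w → x < B → v < w → x + B * v < B * w
  carry {x} {B} v w x<B v<w = begin-strict
    x + B * v   <⟨ +-monoˡ-< (B * v) x<B ⟩
    B + B * v   ≡⟨ *-suc B v ⟨
    B * suc v   ≤⟨ *-monoʳ-≤ B v<w ⟩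
    B * w       ∎
    where open ≤-Reasoning

  value-cong : ∀ B k {f g : ℕ → ℕ} → (∀ i → f i ≡ g i) → value B k f ≡ value B k g
  value-cong B zero    f≡g = refl
  value-cong B (suc k) f≡g = cong₂ (λ x v → x + B * v) (f≡g 0) (value-cong B k (f≡g ∘ suc))

  value-< : ∀ B k {f g i} → (∀ j → f j < B) → i < k → f i < g i →
            (∀ j → i < j → f j ≡ g j) → value B k f < value B k g
  value-< B (suc k) {f} {g} {zero}  f<B _   fi<gi f≡g
    rewrite value-cong B k {f ∘ suc} {g ∘ suc} (λ j → f≡g (suc j) z<s) = +-monoˡ-< _ fi<gi
  value-< B (suc k) {f} {g} {suc i} f<B i<k fi<gi f≡g = ≤-trans
    (carry _ _ (f<B 0) (value-< B k (f<B ∘ suc) (s<s⁻¹ i<k) fi<gi (λ j → f≡g (suc j) ∘ s<s)))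
    (m≤n+m _ (g 0))

  value-bound : ∀ B k {f} → (∀ j → f j < B) → value B k f < B ^ k
  value-bound B zero    f<B = z<s
  value-bound B (suc k) f<B = carry _ _ (f<B 0) (value-bound B k (f<B ∘ suc))

  -- ≪ raises the number whose digits are the parts, and for partitions of n
  -- that number is bounded.
  ≪-ascending : ∀ {ℓ} (P : Partition → Set ℓ) →
                (∀ μ → (∀ ν → size ν ≡ size μ → μ ≪ ν → P ν) → P μ) → ∀ μ → P μ
  ≪-ascending P step μ = go (B ^ n) μ refl (m≤m+n (B ^ n) _)
    where
    -- Parts of a partition of `n` are at most `n`, and nonzero ones have index below `n`; hence `n`
    -- digits in base `n + 1`.
    n = size μ
    B = suc n
    val : Partition → ℕ
    val ν = value B n (part ν)

    digits : ∀ ν → size ν ≡ n → ∀ j → part ν j < B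
    digits ν |ν|≡n j = s≤s (subst (part ν j ≤_) |ν|≡n (entry≤sum (parts ν) j))

    -- Each step costs one unit of fuel and raises `val` by at least one, so the bound persists;
    -- with no fuel left it would contradict `val ν < B ^ n`.
    go : ∀ fuel ν → size ν ≡ n → B ^ n ≤ fuel + val ν → P ν
    go zero       ν |ν|≡n bound = ⊥-elim (<⇒≱ (value-bound B n (digits ν |ν|≡n)) bound)
    go (suc fuel) ν |ν|≡n bound = step ν λ { ρ |ρ|≡|ν| (i , νᵢ<ρᵢ , eq) →
      let |ρ|≡n = trans |ρ|≡|ν| |ν|≡n
          i<n   = subst (i <_) |ρ|≡n (positive-entry⇒index<sum (positive ρ) (≤-trans (s≤s z≤n) νᵢ<ρᵢ))
          val<  = value-< B n (digits ν |ν|≡n) i<n νᵢ<ρᵢ eq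
      in go fuel ρ |ρ|≡n (≤-trans bound (subst (_≤ fuel + val ρ) (+-suc fuel (val ν)) (+-monoʳ-≤ fuel val<))) }

  -- One-row partitions and sorted exponents

  row : ℕ → Partition
  row zero    = mkPartition [] [] []
  row (suc n) = mkPartition (suc n ∷ []) [-] (z<s ∷ [])

  size-row : ∀ n → size (row n) ≡ n
  size-row zero    = refl
  size-row (suc n) = +-identityʳ (suc n)

  -- Against a sequence that is already zero, reverse lexicographic comparison is decided at the
  -- last nonzero entry.
  last-entry : ∀ {x xs} → All (0 <_) (x ∷ xs) →
               ∃[ i ] 0 < entry 0 (x ∷ xs) i × (∀ j → i < j → 0 ≡ entry 0 (x ∷ xs) j)
  last-entry (0<x ∷ [])           = 0 , 0<x , λ { (suc j) _ → refl }
  last-entry (_   ∷ xs>0@(_ ∷ _)) =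
    let i , 0<e , eq = last-entry xs>0 in
    suc i , 0<e , λ { (suc j) i<j → eq j (s<s⁻¹ i<j) }

  -- A one-row partition is zero past its first part, so any partition with a second part exceeds it
  -- at its own last part.
  row-least : ∀ μ → μ ≡ row (size μ) ⊎ row (size μ) ≪ μ
  row-least (mkPartition []             _ _) = inj₁ (partition-≡ refl)
  row-least (mkPartition (zero ∷ [])   _ (() ∷ _))
  row-least (mkPartition (suc x ∷ [])   _ _) = inj₁ (partition-≡ (cong (λ k → suc k ∷ []) (sym (+-identityʳ x))))
  row-least (mkPartition (suc x ∷ _ ∷ _) _ (_ ∷ xs>0)) =
    let i , 0<e , eq = last-entry xs>0 in
    inj₂ (suc i , 0<e , λ { (suc j) i<j → eq j (s<s⁻¹ i<j) })

  toPartition-parts : ∀ ν → toPartition (parts ν) ≡ ν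
  toPartition-parts ν = partition-≡ (≋⇒≡ (↗↭↗⇒≋ ≥-totalOrder (sort-↗ _) (decreasing ν)
    (↭⇒↭ₛ′ (TotalOrder.isEquivalence ≥-totalOrder)
      (subst (λ xs → parts (toPartition (parts ν)) ↭ xs) (filter-all (0 <?_) (positive ν)) (sort-↭ _)))))
    where ≥-totalOrder = DecTotalOrder.totalOrder ≥-decTotalOrder

  -- This is the normal form of an exponent vector under the two invariances of `Sym`: permuting
  -- entries and appending zeros.
  ↭-toPartition : ∀ β → ∃[ k ] β ↭ parts (toPartition β) ++ replicate k 0
  ↭-toPartition β = let k , β↭ = nonzero-first β in
    k , ↭-trans β↭ (++⁺ʳ (replicate k 0) (↭-sym (sort-↭ _)))
    where
    nonzero-first : ∀ β → ∃[ k ] β ↭ filter (0 <?_) β ++ replicate k 0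
    nonzero-first []          = 0 , ↭-refl
    nonzero-first (suc n ∷ β) = let k , β↭ = nonzero-first β in k , prep (suc n) β↭
    nonzero-first (zero ∷ β)  = let k , β↭ = nonzero-first β in
      suc k , ↭-trans (prep 0 β↭) (↭-sym (shift 0 (filter (0 <?_) β) (replicate k 0)))

  -- The zero vector at the length used by `box ns`, whose members are all as long as `ns`.
  origin : List ℕ → List ℤ
  origin = map (λ _ → 0ℤ)

  sum-origin : ∀ ns → sum (map ∣_∣ (origin ns)) ≡ 0
  sum-origin []       = refl
  sum-origin (_ ∷ ns) = sum-origin ns

  −-origin : ∀ ns → map +_ ns − origin ns ≡ map +_ ns
  −-origin []       = refl
  −-origin (n ∷ ns) = cong₂ _∷_ (cong +_ (+-identityʳ n)) (−-origin ns)

  -- Isolates the only index whose term in the convolution can have a constant term; it comes first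
  -- because `upTo` begins with 0.
  box-origin : ∀ ns → ∃[ αs ] box ns ≡ origin ns ∷ αs × All (λ α → 0 < sum (map ∣_∣ α)) αs
  box-origin []       = [] , refl , []
  box-origin (n ∷ ns) with box ns | box-origin ns
  ... | _ | αs , refl , αs>0 =
    _ , refl ,
    -- Either the head is 0 and the tail is not the origin, or the head is positive and the tail is
    -- arbitrary.
    All.++⁺ (All.map⁺ αs>0)
      (All.cartesianProductWith⁺ (≡.setoid ℤ) (≡.setoid (List ℤ)) _∷_ (map +_ (applyUpTo suc n)) (origin ns ∷ αs)
        λ {_} {α} x∈ _ → head>0 α x∈)
    where
    head>0 : ∀ {x} α → x ∈ map +_ (applyUpTo suc n) → 0 < sum (map ∣_∣ (x ∷ α))
    head>0 _ x∈ with ∈-map⁻ +_ x∈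
    ... | _ , k∈ , refl with ∈-applyUpTo⁻ suc k∈
    ...   | _ , _ , refl = z<s

  map-∣∣-+ : ∀ ns → map ∣_∣ (map +_ ns) ≡ ns
  map-∣∣-+ ns = trans (sym (map-∘ ns)) (map-id ns)

open Partitions

module ShiftInvariantOperators {c ℓ₁ ℓ₂ : Level} (K : HeytingField c ℓ₁ ℓ₂) where

  open HeytingField K using (_#_; #⇒invertible; heytingCommutativeRing)
  open HeytingProperties heytingCommutativeRing using (x-0≈x; #-congʳ; x#0y#0→xy#0)
  open SymmetricFunctions K
  open CommutativeRing commutativeRing hiding (zero)
  open CommutativeMonoidSum +-commutativeMonoid using (sum-cong-≋) renaming (sum to ∑)
  open MonoidMult +-monoid using (×-homo-+; ×-congˡ) renaming (_×_ to _×ᴷ_)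
  open RingProperties ring using (-0#≈0#; -‿+-comm; -‿distribʳ-*; [y-z]x≈yx-zx; +-cancelʳ)
    renaming (x∙y⁻¹≈ε⇒x≈y to x-y≈0⇒x≈y; x≈y⇒x∙y⁻¹≈ε to x≈y⇒x-y≈0; //-rightDividesʳ to y+x-x≈y)
  open SemiringExp semiring using (_^_)
  open SemiringMult semiring using (×1-homo-*)
  open SemiringSum semiring using (*-distribˡ-sum)
  open CommutativeSemigroupProperties +-commutativeSemigroup using () renaming (interchange to +-interchange)
  open CommutativeSemigroupProperties *-commutativeSemigroup using (interchange; x∙yz≈y∙xz)
  open SetoidReasoning setoid

  *-cancelˡ-#0 : ∀ {x y z} → x # 0# → x * y ≈ x * z → y ≈ z
  *-cancelˡ-#0 {x} {y} {z} x#0 xy≈xz = trans (sym (x⁻¹[xw]≈w y)) (trans (*-congˡ xy≈xz) (x⁻¹[xw]≈w z))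
    where
    x⁻¹ = proj₁ (#⇒invertible x#0)
    x⁻¹[xw]≈w : ∀ w → x⁻¹ * (x * w) ≈ w
    x⁻¹[xw]≈w w = begin
      x⁻¹ * (x * w)       ≈⟨ *-assoc x⁻¹ x w ⟨
      x⁻¹ * x * w         ≈⟨ *-congʳ (*-congˡ (x-0≈x x)) ⟨
      x⁻¹ * (x - 0#) * w  ≈⟨ *-congʳ (proj₁ (proj₂ (#⇒invertible x#0))) ⟩
      1# * w              ≈⟨ *-identityˡ w ⟩
      w                   ∎

  -- Polynomials

  -- Splitting off the constant coefficient makes evaluation recursive in the degree bound, without
  -- sums over `Fin` or powers of `a`.
  horner : ℕ → Carrier → (ℕ → Carrier) → Carrier
  horner zero    a f = f 0
  horner (suc d) a f = f 0 + a * horner d a (f ∘ suc)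

  evaluate≈horner : ∀ d a f → evaluate a d f ≈ horner d a f
  evaluate≈horner zero    a f = trans (+-identityʳ _) (*-identityˡ (f 0))
  evaluate≈horner (suc d) a f = +-cong (*-identityˡ (f 0)) (begin
    ∑ {suc d} (λ i → a * a ^ toℕ i * f (suc (toℕ i)))
      ≈⟨ sum-cong-≋ {suc d} {x = λ i → a * a ^ toℕ i * f (suc (toℕ i))} (λ i → *-assoc a (a ^ toℕ i) (f (suc (toℕ i)))) ⟩
    ∑ (λ i → a * term i)
      ≈⟨ *-distribˡ-sum a term ⟨
    a * evaluate a d (f ∘ suc)
      ≈⟨ *-congˡ (evaluate≈horner d a (f ∘ suc)) ⟩
    a * horner d a (f ∘ suc) ∎)
    where
    term : Fin (suc d) → Carrier
    term i = a ^ toℕ i * f (suc (toℕ i))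

  horner-cong : ∀ d a {f g} → (∀ i → f i ≈ g i) → horner d a f ≈ horner d a g
  horner-cong zero    a f≈g = f≈g 0
  horner-cong (suc d) a f≈g = +-cong (f≈g 0) (*-congˡ (horner-cong d a (f≈g ∘ suc)))

  horner-vanish : ∀ d a {f} → (∀ i → i ≤ d → f i ≈ 0#) → horner d a f ≈ 0#
  horner-vanish zero    a f≈0 = f≈0 0 z≤n
  horner-vanish (suc d) a f≈0 = trans
    (+-cong (f≈0 0 z≤n) (trans (*-congˡ (horner-vanish d a (λ i → f≈0 (suc i) ∘ s≤s))) (zeroʳ a)))
    (+-identityʳ 0#)

  horner-extend : ∀ {d e} a {f} → d ≤ e → (∀ i → d < i → i ≤ e → f i ≈ 0#) → horner e a f ≈ horner d a f
  horner-extend {e = zero}  a z≤n       f≈0 = refl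
  horner-extend {e = suc e} a z≤n       f≈0 = trans
    (+-congˡ (trans (*-congˡ (horner-vanish e a (λ i i≤e → f≈0 (suc i) (s≤s z≤n) (s≤s i≤e)))) (zeroʳ a)))
    (+-identityʳ _)
  horner-extend             a (s≤s d≤e) f≈0 =
    +-congˡ (*-congˡ (horner-extend a d≤e (λ i d<i i≤e → f≈0 (suc i) (s≤s d<i) (s≤s i≤e))))

  horner-* : ∀ d a x f → horner d a (λ i → x * f i) ≈ x * horner d a f
  horner-* zero    a x f = refl
  horner-* (suc d) a x f = begin
    x * f 0 + a * horner d a (λ i → x * f (suc i)) ≈⟨ +-congˡ (*-congˡ (horner-* d a x (f ∘ suc))) ⟩
    x * f 0 + a * (x * horner d a (f ∘ suc))       ≈⟨ +-congˡ (x∙yz≈y∙xz a x _) ⟩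
    x * f 0 + x * (a * horner d a (f ∘ suc))       ≈⟨ distribˡ x _ _ ⟨
    x * (f 0 + a * horner d a (f ∘ suc))           ∎

  horner-+ : ∀ d a f g → horner d a (λ i → f i + g i) ≈ horner d a f + horner d a g
  horner-+ zero    a f g = refl
  horner-+ (suc d) a f g = begin
    f 0 + g 0 + a * horner d a (λ i → f (suc i) + g (suc i))
      ≈⟨ +-congˡ (trans (*-congˡ (horner-+ d a (f ∘ suc) (g ∘ suc))) (distribˡ a _ _)) ⟩
    f 0 + g 0 + (a * horner d a (f ∘ suc) + a * horner d a (g ∘ suc))
      ≈⟨ +-interchange _ _ _ _ ⟩
    f 0 + a * horner d a (f ∘ suc) + (g 0 + a * horner d a (g ∘ suc)) ∎

  horner-neg : ∀ d a f → horner d a (λ i → - f i) ≈ - horner d a f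
  horner-neg zero    a f = refl
  horner-neg (suc d) a f = begin
    - f 0 + a * horner d a (λ i → - f (suc i)) ≈⟨ +-congˡ (*-congˡ (horner-neg d a (f ∘ suc))) ⟩
    - f 0 + a * - horner d a (f ∘ suc)         ≈⟨ +-congˡ (-‿distribʳ-* a _) ⟨
    - f 0 - a * horner d a (f ∘ suc)           ≈⟨ -‿+-comm _ _ ⟩
    - (f 0 + a * horner d a (f ∘ suc))         ∎

  horner-scale : ∀ d s a f → horner d a (λ i → s ^ i * f i) ≈ horner d (s * a) f
  horner-scale zero    s a f = *-identityˡ (f 0)
  horner-scale (suc d) s a f = +-cong (*-identityˡ (f 0)) (begin
    a * horner d a (λ i → s * s ^ i * f (suc i))   ≈⟨ *-congˡ (horner-cong d a (λ i → *-assoc s (s ^ i) _)) ⟩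
    a * horner d a (λ i → s * (s ^ i * f (suc i))) ≈⟨ *-congˡ (horner-* d a s _) ⟩
    a * (s * horner d a (λ i → s ^ i * f (suc i))) ≈⟨ *-assoc a s _ ⟨
    a * s * horner d a (λ i → s ^ i * f (suc i))   ≈⟨ *-cong (*-comm a s) (horner-scale d s a (f ∘ suc)) ⟩
    s * a * horner d (s * a) (f ∘ suc)             ∎)

  horner-top : ∀ d {f} → (∀ i → i < d → f i ≈ 0#) → horner d 1# f ≈ f d
  horner-top zero    f≈0 = refl
  horner-top (suc d) f≈0 = trans
    (+-cong (f≈0 0 (s≤s z≤n)) (trans (*-identityˡ _) (horner-top d (λ i → f≈0 (suc i) ∘ s≤s))))
    (+-identityˡ _)

  2# : Carrier
  2# = 2 ×ᴷ 1#

  2^≈2^× : ∀ n → 2# ^ n ≈ (2 ℕ.^ n) ×ᴷ 1#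
  2^≈2^× zero    = sym (+-identityʳ 1#)
  2^≈2^× (suc n) = trans (*-congˡ (2^≈2^× n)) (sym (×1-homo-* 2 (2 ℕ.^ n)))

  module _ (char0 : CharacteristicZero) where

    -- The difference is the image of the positive integer `2 ^ n - 2 ^ i`. As `CharacteristicZero`
    -- speaks of successors, `k` is one less than that.
    2^-2^#0 : ∀ {i n} → i < n → (2# ^ n - 2# ^ i) # 0#
    2^-2^#0 {i} {n} i<n = #-congʳ (sym difference) (char0 k)
      where
      2^i<2^n = ℕ.^-monoʳ-< 2 ℕ.≤-refl i<n
      k = 2 ℕ.^ n ℕ.∸ suc (2 ℕ.^ i)
      difference : 2# ^ n - 2# ^ i ≈ suc k ×ᴷ 1#
      difference = begin
        2# ^ n - 2# ^ i                                       ≈⟨ +-cong (2^≈2^× n) (-‿cong (2^≈2^× i)) ⟩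
        (2 ℕ.^ n) ×ᴷ 1# - (2 ℕ.^ i) ×ᴷ 1#                     ≈⟨ +-congʳ (×-congˡ (≡.trans (≡.sym (ℕ.m∸n+n≡m 2^i<2^n)) (ℕ.+-suc k (2 ℕ.^ i)))) ⟩
        (suc k ℕ.+ 2 ℕ.^ i) ×ᴷ 1# - (2 ℕ.^ i) ×ᴷ 1#           ≈⟨ +-congʳ (×-homo-+ 1# (suc k) (2 ℕ.^ i)) ⟩
        suc k ×ᴷ 1# + (2 ℕ.^ i) ×ᴷ 1# - (2 ℕ.^ i) ×ᴷ 1#       ≈⟨ y+x-x≈y _ _ ⟩
        suc k ×ᴷ 1#                                           ∎

    -- For f of degree n + 1, the polynomial 2ⁿ⁺¹ f(x) − f(2x) has degree n and
    -- its coefficients are nonzero multiples of those of f.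
    horner≈0⇒coefficients≈0 : ∀ n {f} → (∀ a → horner n a f ≈ 0#) → ∀ i → i ≤ n → f i ≈ 0#
    horner≈0⇒coefficients≈0 zero        vanish zero z≤n = vanish 0#
    horner≈0⇒coefficients≈0 (suc n) {f} vanish = λ i i≤n → [ below i , (λ { ≡.refl → top }) ]′ (ℕ.m≤n⇒m<n∨m≡n i≤n)
      where
      s = 2# ^ suc n
      g : ℕ → Carrier
      g i = (s - 2# ^ i) * f i

      g-vanish : ∀ a → horner n a g ≈ 0#
      g-vanish a = begin
        horner n a g
          ≈⟨ horner-extend a (ℕ.n≤1+n n) (λ i n<i i≤1+n → trans
               (*-congʳ (trans (+-congˡ (-‿cong (reflexive (≡.cong (2# ^_) (ℕ.≤-antisym i≤1+n n<i))))) (-‿inverseʳ s)))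
               (zeroˡ (f i))) ⟨
        horner (suc n) a g
          ≈⟨ horner-cong (suc n) a (λ i → [y-z]x≈yx-zx (f i) s (2# ^ i)) ⟩
        horner (suc n) a (λ i → s * f i - 2# ^ i * f i)
          ≈⟨ horner-+ (suc n) a (λ i → s * f i) (λ i → - (2# ^ i * f i)) ⟩
        horner (suc n) a (λ i → s * f i) + horner (suc n) a (λ i → - (2# ^ i * f i))
          ≈⟨ +-cong (horner-* (suc n) a s f) (trans (horner-neg (suc n) a (λ i → 2# ^ i * f i)) (-‿cong (horner-scale (suc n) 2# a f))) ⟩
        s * horner (suc n) a f - horner (suc n) (2# * a) f
          ≈⟨ +-cong (trans (*-congˡ (vanish a)) (zeroʳ s)) (trans (-‿cong (vanish (2# * a))) -0#≈0#) ⟩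
        0# + 0#
          ≈⟨ +-identityʳ 0# ⟩
        0# ∎

      below : ∀ i → i < suc n → f i ≈ 0#
      below i i<1+n = *-cancelˡ-#0 (2^-2^#0 i<1+n)
        (trans (horner≈0⇒coefficients≈0 n g-vanish i (ℕ.s≤s⁻¹ i<1+n)) (sym (zeroʳ _)))

      -- With all lower coefficients gone, the value at 1 is the top coefficient.
      top : f (suc n) ≈ 0#
      top = trans (sym (horner-top (suc n) below)) (vanish 1#)

    -- The bounds `d` and `e` need not agree, so both polynomials are padded to the larger one, and
    -- their difference vanishes at every point.
    evaluate-injective : ∀ {d e f g} → (∀ i → d < i → f i ≈ 0#) → (∀ i → e < i → g i ≈ 0#) →
                         (∀ a → evaluate a d f ≈ evaluate a e g) → ∀ i → f i ≈ g i
    evaluate-injective {d} {e} {f} {g} f-bounded g-bounded f≈g i with i ℕ.≤? d ℕ.⊔ e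
    ... | no  i≰N = trans
      (f-bounded i (ℕ.≤-<-trans (ℕ.m≤m⊔n d e) (ℕ.≰⇒> i≰N)))
      (sym (g-bounded i (ℕ.≤-<-trans (ℕ.m≤n⊔m d e) (ℕ.≰⇒> i≰N))))
    ... | yes i≤N = x-y≈0⇒x≈y _ _ (horner≈0⇒coefficients≈0 N difference i i≤N)
      where
      N = d ℕ.⊔ e
      difference : ∀ a → horner N a (λ i → f i - g i) ≈ 0#
      difference a = begin
        horner N a (λ i → f i - g i)              ≈⟨ trans (horner-+ N a f _) (+-congˡ (horner-neg N a g)) ⟩
        horner N a f - horner N a g               ≈⟨ +-cong (horner-extend a (ℕ.m≤m⊔n d e) (λ i d<i _ → f-bounded i d<i))
                                                            (-‿cong (horner-extend a (ℕ.m≤n⊔m d e) (λ i e<i _ → g-bounded i e<i))) ⟩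
        horner d a f - horner e a g               ≈⟨ +-cong (evaluate≈horner d a f) (-‿cong (evaluate≈horner e a g)) ⟨
        evaluate a d f - evaluate a e g           ≈⟨ x≈y⇒x-y≈0 (f≈g a) ⟩
        0#                                        ∎

  -- Sums over lists

  ∑[_] : ∀ {a} {A : Set a} → List A → (A → Carrier) → Carrier
  ∑[ xs ] f = foldr (λ x s → f x + s) 0# xs

  module _ {a} {A : Set a} where

    ∑-cong : ∀ (xs : List A) {f g : A → Carrier} → (∀ x → f x ≈ g x) → ∑[ xs ] f ≈ ∑[ xs ] g
    ∑-cong []       f≈g = refl
    ∑-cong (x ∷ xs) f≈g = +-cong (f≈g x) (∑-cong xs f≈g)

    ∑-distribˡ : ∀ (xs : List A) x f → ∑[ xs ] (λ y → x * f y) ≈ x * ∑[ xs ] f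
    ∑-distribˡ []       x f = sym (zeroʳ x)
    ∑-distribˡ (y ∷ xs) x f = trans (+-congˡ (∑-distribˡ xs x f)) (sym (distribˡ x _ _))

    ∑-vanish : ∀ {xs : List A} {f} → All (λ x → f x ≈ 0#) xs → ∑[ xs ] f ≈ 0#
    ∑-vanish []            = refl
    ∑-vanish (fx≈0 ∷ f≈0) = trans (+-cong fx≈0 (∑-vanish f≈0)) (+-identityʳ 0#)

    ∑-single : ∀ {xs : List A} {x f} → Unique xs → x ∈ xs → (∀ y → x ≢ y → f y ≈ 0#) → ∑[ xs ] f ≈ f x
    ∑-single (x∉xs ∷ _)  (here ≡.refl) f≈0 = trans (+-congˡ (∑-vanish (All.map (f≈0 _) x∉xs))) (+-identityʳ _)
    ∑-single (y∉xs ∷ xs!) (there x∈xs) f≈0 = trans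
      (+-cong (f≈0 _ (λ x≡y → All.lookup y∉xs x∈xs (≡.sym x≡y))) (∑-single xs! x∈xs f≈0))
      (+-identityˡ _)

    coeff-∑ˢ : ∀ (xs : List A) f β → coeff (∑ˢ (map f xs)) β ≡ ∑[ xs ] (λ x → coeff (f x) β)
    coeff-∑ˢ []       f β = ≡.refl
    coeff-∑ˢ (x ∷ xs) f β = ≡.cong (λ s → coeff (f x) β + s) (coeff-∑ˢ xs f β)

    coeff-∑ʸ : ∀ (xs : List A) f i β →
               coeff (coeffʸ (∑ʸ (map f xs)) i) β ≡ ∑[ xs ] (λ x → coeff (coeffʸ (f x) i) β)
    coeff-∑ʸ []       f i β = ≡.refl
    coeff-∑ʸ (x ∷ xs) f i β = ≡.cong (λ s → coeff (coeffʸ (f x) i) β + s) (coeff-∑ʸ xs f i β)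

  -- Expansions in monomial symmetric functions

  indicator-≡ : ∀ μ → indicator μ (parts μ) ≈ 1#
  indicator-≡ μ = reflexive (≡.cong (λ b → if b then 1# else 0#)
    (dec-true (≡-dec ℕ._≟_ (parts μ) (parts μ)) ≡.refl))

  indicator-≢ : ∀ {μ ν} → ν ≢ μ → indicator μ (parts ν) ≈ 0#
  indicator-≢ {μ} {ν} ν≢μ = reflexive (≡.cong (λ b → if b then 1# else 0#)
    (dec-false (≡-dec ℕ._≟_ (parts ν) (parts μ)) (ν≢μ ∘ partition-≡)))

  coeff-monomials : ∀ {xs} (b : Partition → Carrier) β → Unique xs → toPartition β ∈ xs →
                    coeff (∑ˢ (map (λ μ → b μ • monomial μ) xs)) β ≈ b (toPartition β)
  coeff-monomials {xs} b β xs! ν∈xs = begin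
    coeff (∑ˢ (map (λ μ → b μ • monomial μ) xs)) β ≡⟨ coeff-∑ˢ xs (λ μ → b μ • monomial μ) β ⟩
    ∑[ xs ] (λ μ → b μ * indicator μ (parts ν))    ≈⟨ ∑-single xs! ν∈xs (λ μ ν≢μ → trans (*-congˡ (indicator-≢ ν≢μ)) (zeroʳ (b μ))) ⟩
    b ν * indicator ν (parts ν)                    ≈⟨ *-congˡ (indicator-≡ ν) ⟩
    b ν * 1#                                       ≈⟨ *-identityʳ (b ν) ⟩
    b ν                                            ∎
    where ν = toPartition β

  coeff-monomials-∉ : ∀ {xs} (b : Partition → Carrier) β → (∀ {μ} → μ ∈ xs → toPartition β ≢ μ) →
                      coeff (∑ˢ (map (λ μ → b μ • monomial μ) xs)) β ≈ 0#
  coeff-monomials-∉ {xs} b β ν∉xs = trans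
    (reflexive (coeff-∑ˢ xs (λ μ → b μ • monomial μ) β))
    (∑-vanish (All.tabulate λ {μ} μ∈xs → trans (*-congˡ (indicator-≢ (ν∉xs μ∈xs))) (zeroʳ (b μ))))

  padded-replicate : ∀ q β k → coeff q (β ++ replicate k 0) ≈ coeff q β
  padded-replicate q β zero    = reflexive (≡.cong (coeff q) (++-identityʳ β))
  padded-replicate q β (suc k) = begin
    coeff q (β ++ 0 ∷ replicate k 0)        ≡⟨ ≡.cong (coeff q) (++-assoc β [ 0 ] (replicate k 0)) ⟨
    coeff q ((β ++ [ 0 ]) ++ replicate k 0) ≈⟨ padded-replicate q (β ++ [ 0 ]) k ⟩
    coeff q (β ++ [ 0 ])                    ≈⟨ padded q β ⟩
    coeff q β                               ∎

  coeff-toPartition : ∀ q β → coeff q (parts (toPartition β)) ≈ coeff q β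
  coeff-toPartition q β = let k , β↭ = ↭-toPartition β in
    sym (trans (symmetric q β↭) (padded-replicate q (parts (toPartition β)) k))

  -- The enumeration of partitions by size is a parameter because a full sequence already provides
  -- one in its `support` fields.
  module _ (partitions : ℕ → List Partition)
           (partitions! : ∀ n → Unique (partitions n))
           (∈-partitions : ∀ {n μ} → μ ∈ partitions n ⇔ size μ ≡ n) where

    component : Sym → ℕ → Sym
    component q n = ∑ˢ (map (λ μ → coeff q (parts μ) • monomial μ) (partitions n))

    -- At `β` only the component of degree `sum β` contributes; if that exceeds `degree q`, it is
    -- missing from the sum, and the coefficient of `q` is zero too.
    monomial-expansion : ∀ q → q ≈ˢ ∑ˢ (map (component q) (upTo (suc (degree q))))
    monomial-expansion q β = sym (trans (reflexive (coeff-∑ˢ degrees (component q) β)) total)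
      where
      n = sum β
      degrees = upTo (suc (degree q))

      other : ∀ m → n ≢ m → coeff (component q m) β ≈ 0#
      other m n≢m = coeff-monomials-∉ (coeff q ∘ parts) β λ { μ∈ ≡.refl →
        n≢m (≡.trans (≡.sym (size-toPartition β)) (Equivalence.to ∈-partitions μ∈)) }

      total : ∑[ degrees ] (λ m → coeff (component q m) β) ≈ coeff q β
      total with n ℕ.≤? degree q
      ... | yes n≤d = begin
        ∑[ degrees ] (λ m → coeff (component q m) β) ≈⟨ ∑-single (upTo⁺ (suc (degree q))) (∈-upTo⁺ (s≤s n≤d)) other ⟩
        coeff (component q n) β                      ≈⟨ coeff-monomials (coeff q ∘ parts) β (partitions! n) (Equivalence.from ∈-partitions (size-toPartition β)) ⟩
        coeff q (parts (toPartition β))              ≈⟨ coeff-toPartition q β ⟩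
        coeff q β                                    ∎
      ... | no  n≰d = trans
        (∑-vanish (All.tabulate {xs = degrees} λ {m} m∈ → other m λ { ≡.refl → n≰d (ℕ.s≤s⁻¹ (∈-upTo⁻ m∈)) }))
        (sym (bounded q (ℕ.≰⇒> n≰d)))

  -- Linear functionals

  -- Meant for two functionals of `q`: a coefficient of `F q`, and a constant times a coefficient of
  -- `q`.
  record IsFunctional (φ : Sym → Carrier) : Set (c ⊔ ℓ₁) where
    field
      φ-cong : ∀ {q r} → q ≈ˢ r → φ q ≈ φ r
      φ-+    : ∀ q r → φ (q +ˢ r) ≈ φ q + φ r
      φ-•    : ∀ x q → φ (x • q) ≈ x * φ q

    φ-0 : φ 0ˢ ≈ 0#
    φ-0 = trans (φ-cong {r = 0# • 0ˢ} (λ _ → sym (zeroʳ 0#))) (trans (φ-• 0# 0ˢ) (zeroˡ _))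

  open IsFunctional

  module _ {φ ψ : Sym → Carrier} (Φ : IsFunctional φ) (Ψ : IsFunctional ψ) where

    agree-cong : ∀ {q r} → q ≈ˢ r → φ q ≈ ψ q → φ r ≈ ψ r
    agree-cong {q} {r} q≈r eq = trans (sym (φ-cong Φ {q} {r} q≈r)) (trans eq (φ-cong Ψ {q} {r} q≈r))

    agree-+ : ∀ q r → φ q ≈ ψ q → φ r ≈ ψ r → φ (q +ˢ r) ≈ ψ (q +ˢ r)
    agree-+ q r eq-q eq-r = trans (φ-+ Φ q r) (trans (+-cong eq-q eq-r) (sym (φ-+ Ψ q r)))

    agree-•⁺ : ∀ x q → φ q ≈ ψ q → φ (x • q) ≈ ψ (x • q)
    agree-•⁺ x q eq = trans (φ-• Φ x q) (trans (*-congˡ eq) (sym (φ-• Ψ x q)))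

    agree-•⁻ : ∀ {x} q → x # 0# → φ (x • q) ≈ ψ (x • q) → φ q ≈ ψ q
    agree-•⁻ {x} q x#0 eq = *-cancelˡ-#0 x#0 (trans (sym (φ-• Φ x q)) (trans eq (φ-• Ψ x q)))

    agree-+ˡ⁻ : ∀ q r → φ r ≈ ψ r → φ (q +ˢ r) ≈ ψ (q +ˢ r) → φ q ≈ ψ q
    agree-+ˡ⁻ q r eq-r eq = +-cancelʳ (φ r) _ _ (begin
      φ q + φ r     ≈⟨ φ-+ Φ q r ⟨
      φ (q +ˢ r)    ≈⟨ eq ⟩
      ψ (q +ˢ r)    ≈⟨ φ-+ Ψ q r ⟩
      ψ q + ψ r     ≈⟨ +-congˡ eq-r ⟨
      ψ q + φ r     ∎)

    agree-+ʳ⁻ : ∀ q r → φ q ≈ ψ q → φ (q +ˢ r) ≈ ψ (q +ˢ r) → φ r ≈ ψ r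
    agree-+ʳ⁻ q r eq-q eq = agree-+ˡ⁻ r q eq-q
      (agree-cong {q +ˢ r} {r +ˢ q} (λ β → +-comm (coeff q β) (coeff r β)) eq)

    module _ {a} {A : Set a} (f : A → Sym) where

      agree-∑ : ∀ {xs} → All (λ x → φ (f x) ≈ ψ (f x)) xs → φ (∑ˢ (map f xs)) ≈ ψ (∑ˢ (map f xs))
      agree-∑ []                = trans (φ-0 Φ) (sym (φ-0 Ψ))
      agree-∑ {x ∷ xs} (eq ∷ eqs) = agree-+ (f x) (∑ˢ (map f xs)) eq (agree-∑ eqs)

      -- One elimination: terms on which agreement is known are cancelled until only the one at `x`
      -- remains.
      agree-∑⁻ : ∀ {x xs} → Unique xs → x ∈ xs → (∀ {y} → y ∈ xs → x ≢ y → φ (f y) ≈ ψ (f y)) →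
                 φ (∑ˢ (map f xs)) ≈ ψ (∑ˢ (map f xs)) → φ (f x) ≈ ψ (f x)
      agree-∑⁻ {x} {_ ∷ xs} (x∉xs ∷ _) (here ≡.refl) others eq = agree-+ˡ⁻ (f x) (∑ˢ (map f xs))
        (agree-∑ (All.tabulate λ y∈xs → others (there y∈xs) (All.lookup x∉xs y∈xs))) eq
      agree-∑⁻ {x} {y ∷ xs} (y∉xs ∷ xs!) (there x∈xs) others eq = agree-∑⁻ xs! x∈xs (others ∘ there)
        (agree-+ʳ⁻ (f y) (∑ˢ (map f xs)) (others (here ≡.refl) (λ x≡y → All.lookup y∉xs x∈xs (≡.sym x≡y))) eq)

  -- Functionals determined by a full sequence

  module _ {p : Partition → Sym} (full : IsFull p) where

    open module Full ν = IsFullAt (full ν)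

    -- The partition with a single part is the least one of its size, so
    -- the expansion of p at its conjugate ranges over all partitions.
    partitionsOf : ℕ → List Partition
    partitionsOf n = support (conjugate (row n))

    ∈-partitionsOf : ∀ {n μ} → μ ∈ partitionsOf n ⇔ size μ ≡ n
    ∈-partitionsOf {n} {μ} = mk⇔
      (λ μ∈ → ≡.trans (proj₁ (Equivalence.to (complete _ μ) μ∈)) size-ν)
      (λ { ≡.refl → Equivalence.from (complete _ μ) (≡.sym size-ν , ≡.subst (λ ρ → μ ≡ ρ ⊎ ρ ≪ μ)
        (≡.sym (conjugate-involutive (row n))) (row-least μ)) })
      where
      size-ν : size (conjugate (row n)) ≡ n
      size-ν = ≡.trans (size-conjugate (row n)) (size-row n)

    module _ {φ ψ : Sym → Carrier} (Φ : IsFunctional φ) (Ψ : IsFunctional ψ)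
             (agree : ∀ ν → φ (p ν) ≈ ψ (p ν)) where

      -- Back substitution in the triangular system: `p` at `conjugate μ` is led by `monomial μ`
      -- with a cancellable coefficient, and its other monomials lie above `μ`, where agreement is
      -- the induction hypothesis.
      agree-monomial : ∀ μ → φ (monomial μ) ≈ ψ (monomial μ)
      agree-monomial = ≪-ascending _ step
        where
        step : ∀ μ → (∀ ν → size ν ≡ size μ → μ ≪ ν → φ (monomial ν) ≈ ψ (monomial ν)) →
               φ (monomial μ) ≈ ψ (monomial μ)
        step μ higher = agree-•⁻ Φ Ψ (monomial μ) (≡.subst (λ ρ → b ν ρ # 0#) ν′≡μ (leading ν))
          (agree-∑⁻ Φ Ψ term (unique ν)
            (Equivalence.from (complete ν μ) (≡.sym (size-conjugate μ) , inj₁ (≡.sym ν′≡μ)))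
            others
            (agree-cong Φ Ψ {p ν} {∑ˢ (map term (support ν))} (expansion ν) (agree ν)))
          where
          ν = conjugate μ
          ν′≡μ : conjugate ν ≡ μ
          ν′≡μ = conjugate-involutive μ
          term : Partition → Sym
          term ρ = b ν ρ • monomial ρ
          others : ∀ {ρ} → ρ ∈ support ν → μ ≢ ρ → φ (term ρ) ≈ ψ (term ρ)
          others {ρ} ρ∈ μ≢ρ with Equivalence.to (complete ν ρ) ρ∈
          ... | _   , inj₁ ρ≡ν′ = ⊥-elim (μ≢ρ (≡.sym (≡.trans ρ≡ν′ ν′≡μ)))
          ... | |ρ| , inj₂ ν′≪ρ = agree-•⁺ Φ Ψ (b ν ρ) (monomial ρ)
            (higher ρ (≡.trans |ρ| (size-conjugate μ)) (≡.subst (_≪ ρ) ν′≡μ ν′≪ρ))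

      full-determines : ∀ q → φ q ≈ ψ q
      full-determines q = agree-cong Φ Ψ {∑ˢ (map (comp q) degrees)} {q} (λ β → sym (expand q β))
        (agree-∑ Φ Ψ (comp q) (All.tabulate {xs = degrees} λ {n} _ →
          agree-∑ Φ Ψ (λ μ → coeff q (parts μ) • monomial μ) (All.tabulate {xs = partitionsOf n} λ {μ} _ →
            agree-•⁺ Φ Ψ (coeff q (parts μ)) (monomial μ) (agree-monomial μ))))
        where
        degrees = upTo (suc (degree q))
        comp = component partitionsOf (λ n → unique _) ∈-partitionsOf
        expand = monomial-expansion partitionsOf (λ n → unique _) ∈-partitionsOf

  -- Shift-invariant operators

  D : ℕ → Sym → Sym
  D j q = coeffʸ (Eʸ q) j

  -- Writes the series in `a` with `+ˢ` and `•` alone, the operations that a functional respects.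
  hornerˢ : ℕ → Carrier → (ℕ → Sym) → Sym
  hornerˢ zero    a f = f 0
  hornerˢ (suc d) a f = f 0 +ˢ a • hornerˢ d a (f ∘ suc)

  coeff-hornerˢ : ∀ d a f β → coeff (hornerˢ d a f) β ≡ horner d a (λ j → coeff (f j) β)
  coeff-hornerˢ zero    a f β = ≡.refl
  coeff-hornerˢ (suc d) a f β = ≡.cong (λ s → coeff (f 0) β + a * s) (coeff-hornerˢ d a (f ∘ suc) β)

  module _ {φ : Sym → Carrier} (Φ : IsFunctional φ) where

    φ-hornerˢ : ∀ d a f → φ (hornerˢ d a f) ≈ horner d a (φ ∘ f)
    φ-hornerˢ zero    a f = refl
    φ-hornerˢ (suc d) a f = trans (φ-+ Φ (f 0) (a • hornerˢ d a (f ∘ suc)))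
      (+-congˡ (trans (φ-• Φ a (hornerˢ d a (f ∘ suc))) (*-congˡ (φ-hornerˢ d a (f ∘ suc)))))

    -- Turns `φ (E a q)` into a polynomial in `a`, so that coefficients can be compared.
    φ-E : ∀ a q → φ (E a q) ≈ evaluate a (degree q) (λ j → φ (D j q))
    φ-E a q = begin
      φ (E a q)                                   ≈⟨ φ-cong Φ {E a q} {hornerˢ (degree q) a (λ j → D j q)} (λ β → trans
                                                       (evaluate≈horner (degree q) a (λ j → coeff q (j ∷ β)))
                                                       (sym (reflexive (coeff-hornerˢ (degree q) a (λ j → D j q) β)))) ⟩
      φ (hornerˢ (degree q) a (λ j → D j q))      ≈⟨ φ-hornerˢ (degree q) a (λ j → D j q) ⟩
      horner (degree q) a (λ j → φ (D j q))       ≈⟨ evaluate≈horner (degree q) a (λ j → φ (D j q)) ⟨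
      evaluate a (degree q) (λ j → φ (D j q))     ∎

  module _ {F : Sym → Sym[y]} (linear : IsLinear F) where

    coefficient-isFunctional : ∀ i β → IsFunctional (λ q → coeff (coeffʸ (F q) i) β)
    coefficient-isFunctional i β = record
      { φ-cong = λ {q} {r} q≈r → ⟦⟧-cong {q} {r} q≈r i β
      ; φ-+    = λ q r → +ᴹ-homo q r i β
      ; φ-•    = λ x q → *ₗ-homo x q i β
      }
      where open IsLinear linear

    -- Compare coefficients of powers of a in EᵃF q = F Eᵃq.
    shift-coefficient : CharacteristicZero → ShiftInvariant F → ∀ q i j β →
                        coeff (coeffʸ (F q) i) (j ∷ β) ≈ coeff (coeffʸ (F (D j q)) i) β
    shift-coefficient char0 shift q i j β = evaluate-injective char0
      {f = λ j → coeff (coeffʸ (F q) i) (j ∷ β)} {g = λ j → coeff (coeffʸ (F (D j q)) i) β}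
      -- The two sides have unrelated bounds: on the left the degree of a coefficient of `F q`, on
      -- the right that of `q`, past which `D j q` is zero and linearity gives zero.
      (λ j d<j → bounded (coeffʸ (F q) i) (ℕ.<-≤-trans d<j (ℕ.m≤m+n j (sum β))))
      (λ j d<j → trans (φ-cong Φ {D j q} {0ˢ} (boundedʸ (Eʸ q) d<j)) (φ-0 Φ))
      (λ a → trans (shift a q i β) (φ-E Φ a q))
      j
      where Φ = coefficient-isFunctional i β

  -- Scaling and constant term of the convolution

  module _ (p : Partition → Sym) where

    at-NonNegative : ∀ {α} → NonNegative α → p at α ≡ p (toPartition (map ∣_∣ α))
    at-NonNegative {α} α≥0 = ≡.cong (λ b → if b then p (toPartition (map ∣_∣ α)) else 0ˢ)
      (dec-true (all? (0ℤ ℤ.≤?_) α) α≥0)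

    at-+ : ∀ ns → p at map +_ ns ≡ p (toPartition ns)
    at-+ ns = ≡.trans (at-NonNegative (All.map⁺ (All.universal (λ _ → ℤ.+≤+ z≤n) ns)))
      (≡.cong (p ∘ toPartition) (map-∣∣-+ ns))

    at-origin : ∀ ns → p at origin ns ≡ p (row 0)
    at-origin ns = ≡.trans (at-NonNegative (All.map⁺ (All.universal (λ _ → ℤ.+≤+ z≤n) ns)))
      (≡.cong p (size0⇒≡ (≡.trans (size-toPartition (map ∣_∣ (origin ns))) (sum-origin ns)) ≡.refl))

    at-• : ∀ x α → (λ ν → x • p ν) at α ≈ˢ x • (p at α)
    at-• x α β with does (all? (0ℤ ℤ.≤?_) α)
    ... | true  = refl
    ... | false = sym (zeroʳ x)

    coeff-convolution : ∀ ν i β → coeff (coeffʸ (convolution p ν) i) β ≡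
      ∑[ box (parts ν) ] (λ α → coeff (p at (map +_ (parts ν) − α)) [ i ] * coeff (p at α) β)
    coeff-convolution ν = coeff-∑ʸ (box (parts ν)) (λ α → (p at α) · (p at (map +_ (parts ν) − α)) ⟨y⟩)

    -- Each term is a product of two members of the family, and each brings one factor `x`.
    convolution-• : ∀ x ν i β → coeff (coeffʸ (convolution (λ ν → x • p ν) ν) i) β ≈
                                x * x * coeff (coeffʸ (convolution p ν) i) β
    convolution-• x ν i β = begin
      coeff (coeffʸ (convolution xp ν) i) β
        ≡⟨ coeff-∑ʸ αs (λ α → (xp at α) · (xp at α′ α) ⟨y⟩) i β ⟩
      ∑[ αs ] (λ α → coeff (xp at α′ α) [ i ] * coeff (xp at α) β)
        ≈⟨ ∑-cong αs (λ α → trans (*-cong (at-• x (α′ α) [ i ]) (at-• x α β)) (interchange _ _ _ _)) ⟩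
      ∑[ αs ] (λ α → x * x * (coeff (p at α′ α) [ i ] * coeff (p at α) β))
        ≈⟨ ∑-distribˡ αs (x * x) _ ⟩
      x * x * ∑[ αs ] (λ α → coeff (p at α′ α) [ i ] * coeff (p at α) β)
        ≡⟨ ≡.cong (λ s → x * x * s) (coeff-convolution ν i β) ⟨
      x * x * coeff (coeffʸ (convolution p ν) i) β ∎
      where
      αs = box (parts ν)
      xp : Partition → Sym
      xp ν = x • p ν
      α′ : List ℤ → List ℤ
      α′ α = map +_ (parts ν) − α

    -- The absolute values do no harm: for nonnegative `α` their sum is the degree of `p at α`, and
    -- otherwise `p at α` is `0ˢ`.
    constant-term-at : (∀ ν → Homogeneous (size ν) (p ν)) → ∀ α → 0 < sum (map ∣_∣ α) → coeff (p at α) [] ≈ 0#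
    constant-term-at hom α 0<α with does (all? (0ℤ ℤ.≤?_) α)
    ... | true  = hom (toPartition (map ∣_∣ α)) [] λ 0≡ →
      ℕ.<-irrefl (≡.trans 0≡ (size-toPartition (map ∣_∣ α))) 0<α
    ... | false = refl

    convolution-constant-term : (∀ ν → Homogeneous (size ν) (p ν)) → ∀ ν i →
      coeff (coeffʸ (convolution p ν) i) [] ≈ coeff (p (row 0)) [] * coeff (p ν) [ i ]
    convolution-constant-term hom ν i with box-origin (parts ν)
    ... | αs , box≡ , αs>0 = begin
      coeff (coeffʸ (convolution p ν) i) []        ≡⟨ coeff-convolution ν i [] ⟩
      ∑[ box ns ] term                             ≡⟨ ≡.cong (λ xs → ∑[ xs ] term) box≡ ⟩
      term (origin ns) + ∑[ αs ] term              ≈⟨ +-congˡ (∑-vanish (All.map (λ {α} 0<α →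
                                                        trans (*-congˡ (constant-term-at hom α 0<α)) (zeroʳ _)) αs>0)) ⟩
      term (origin ns) + 0#                        ≈⟨ +-identityʳ _ ⟩
      term (origin ns)                             ≡⟨ ≡.cong₂ (λ r s → coeff r [ i ] * coeff s []) p-at-ν (at-origin ns) ⟩
      coeff (p ν) [ i ] * coeff (p (row 0)) []     ≈⟨ *-comm _ _ ⟩
      coeff (p (row 0)) [] * coeff (p ν) [ i ]     ∎
      where
      ns = parts ν
      term : List ℤ → Carrier
      term α = coeff (p at (map +_ ns − α)) [ i ] * coeff (p at α) []
      p-at-ν : p at (map +_ ns − origin ns) ≡ p ν
      p-at-ν = ≡.trans (≡.cong (p at_) (−-origin ns)) (≡.trans (at-+ ns) (≡.cong p (toPartition-parts ν)))

  -- The empty partition is its own conjugate, so the constant term is the leading coefficient of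
  -- the expansion.
  constant-term#0 : ∀ {q} → IsFullAt (row 0) q → coeff q [] # 0#
  constant-term#0 {q} full = #-congʳ (sym coeff≈b) (≡.subst (λ μ → b μ # 0#) (≡.sym ∅≡∅′) leading)
    where
    open IsFullAt full
    ∅≡∅′ : toPartition [] ≡ conjugate (row 0)
    ∅≡∅′ = ≡.trans (toPartition-parts (row 0)) (partition-≡ ≡.refl)
    coeff≈b : coeff q [] ≈ b (toPartition [])
    coeff≈b = trans (expansion []) (coeff-monomials b [] unique
      (Equivalence.from (complete (toPartition [])) (size-toPartition [] , inj₁ ∅≡∅′)))

  isFullAt-• : ∀ {x ν q} → x # 0# → IsFullAt ν q → IsFullAt ν (x • q)
  isFullAt-• {x} {ν} {q} x#0 full = record
    { homogeneous = λ β |β|≢ → trans (*-congˡ (homogeneous β |β|≢)) (zeroʳ x)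
    ; support     = support
    ; unique      = unique
    ; complete    = complete
    ; b           = λ μ → x * b μ
    ; leading     = x#0y#0→xy#0 x#0 leading
    ; expansion   = λ β → begin
        x * coeff q β
          ≈⟨ *-congˡ (trans (expansion β) (reflexive (coeff-∑ˢ support (λ μ → b μ • monomial μ) β))) ⟩
        x * ∑[ support ] (λ μ → b μ * coeff (monomial μ) β)
          ≈⟨ ∑-distribˡ support x _ ⟨
        ∑[ support ] (λ μ → x * (b μ * coeff (monomial μ) β))
          ≈⟨ ∑-cong support (λ μ → sym (*-assoc x (b μ) _)) ⟩
        ∑[ support ] (λ μ → x * b μ * coeff (monomial μ) β)
          ≡⟨ coeff-∑ˢ support (λ μ → (x * b μ) • monomial μ) β ⟨
        coeff (∑ˢ (map (λ μ → (x * b μ) • monomial μ) support)) β ∎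
    }
    where open IsFullAt full

  scaled-coeff-isFunctional : ∀ x β → IsFunctional (λ q → x * coeff q β)
  scaled-coeff-isFunctional x β = record
    { φ-cong = λ q≈r → *-congˡ (q≈r β)
    ; φ-+    = λ q r → distribˡ x _ _
    ; φ-•    = λ z q → x∙yz≈y∙xz x z _
    }

theorem3 : ∀ {c ℓ₁ ℓ₂} (K : HeytingField c ℓ₁ ℓ₂) →
    let open HeytingField K
        open SymmetricFunctions K
    in CharacteristicZero →
       (p : Partition → Sym) → IsFull p →
       (F : Sym → Sym[y]) → IsLinear F → ShiftInvariant F →
       (∀ ν → F (p ν) ≈ʸ convolution p ν) →
       ∃[ a ] a # 0#
            × (∀ q → F q ≈ʸ (a •ʸ Eʸ q))
            × (∃[ a⁻¹ ] a * a⁻¹ ≈ 1# × IsFullDividedPower (λ ν → a⁻¹ • p ν))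
theorem3 K char0 p full F linear shift F-p =
  a , a#0 , (λ q i β → F≈aE β q i) , a⁻¹ , aa⁻¹≈1 , record
    { isFull       = λ ν → isFullAt-• a⁻¹#0 (full ν)
    ; dividedPower = λ ν i β → begin
        -- Inserting `a⁻¹ * a` gives the factor `a` that turns `Eʸ` into `F`, and leaves the square
        -- of `a⁻¹` that the convolution absorbs.
        a⁻¹ * coeff (p ν) (i ∷ β)                           ≈⟨ *-congˡ (trans (*-congʳ (trans (*-comm a⁻¹ a) aa⁻¹≈1)) (*-identityˡ _)) ⟨
        a⁻¹ * (a⁻¹ * a * coeff (p ν) (i ∷ β))               ≈⟨ *-congˡ (*-assoc a⁻¹ a _) ⟩
        a⁻¹ * (a⁻¹ * (a * coeff (p ν) (i ∷ β)))             ≈⟨ *-assoc a⁻¹ a⁻¹ _ ⟨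
        a⁻¹ * a⁻¹ * (a * coeff (p ν) (i ∷ β))               ≈⟨ *-congˡ (F≈aE β (p ν) i) ⟨
        a⁻¹ * a⁻¹ * coeff (coeffʸ (F (p ν)) i) β            ≈⟨ *-congˡ (F-p ν i β) ⟩
        a⁻¹ * a⁻¹ * coeff (coeffʸ (convolution p ν) i) β    ≈⟨ convolution-• p a⁻¹ ν i β ⟨
        coeff (coeffʸ (convolution (λ ν → a⁻¹ • p ν) ν) i) β ∎
    }
  where
  open ShiftInvariantOperators K
  open HeytingField K using (Carrier; _#_; #⇒invertible; heytingCommutativeRing)
  open HeytingProperties heytingCommutativeRing using (x-0≈x; invertibleʳ⇒#)
  open SymmetricFunctions K
  open CommutativeRing commutativeRing hiding (Carrier; zero)
  open SetoidReasoning setoid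

  a : Carrier
  a = coeff (p (row 0)) []

  a#0 : a # 0#
  a#0 = constant-term#0 (full (row 0))

  a⁻¹ : Carrier
  a⁻¹ = proj₁ (#⇒invertible a#0)

  aa⁻¹≈1 : a * a⁻¹ ≈ 1#
  aa⁻¹≈1 = trans (*-congʳ (sym (x-0≈x a))) (proj₂ (proj₂ (#⇒invertible a#0)))

  a⁻¹#0 : a⁻¹ # 0#
  a⁻¹#0 = invertibleʳ⇒# (a , trans (*-congʳ (x-0≈x a⁻¹)) (trans (*-comm a⁻¹ a) aa⁻¹≈1))

  -- Induction on the exponents of x for all `q` at once, since each step replaces `q` by `D j q`.
  F≈aE : ∀ β q i → coeff (coeffʸ (F q) i) β ≈ a * coeff q (i ∷ β)
  F≈aE []      q i = full-determines full
    (coefficient-isFunctional linear i []) (scaled-coeff-isFunctional a [ i ])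
    (λ ν → trans (F-p ν i []) (convolution-constant-term p (IsFullAt.homogeneous ∘ full) ν i)) q
  F≈aE (j ∷ β) q i = begin
    coeff (coeffʸ (F q) i) (j ∷ β)     ≈⟨ shift-coefficient linear char0 shift q i j β ⟩
    coeff (coeffʸ (F (D j q)) i) β     ≈⟨ F≈aE β (D j q) i ⟩
    -- `D j` puts its exponent in front of the exponent `i` of y; the symmetry of `q` restores the
    -- order.
    a * coeff q (j ∷ i ∷ β)            ≈⟨ *-congˡ (symmetric q (swap j i ↭-refl)) ⟩
    a * coeff q (i ∷ j ∷ β)            ∎
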